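{- Let $C_n$ denote the cycle on $n$ vertices. If $n\geq 5$, then $(C_n)^3$ is $5$-ordered Hamiltonian.
   Context: All graphs are finite simple graphs. $d_G(v,w)$ denotes the distance in $G$ between vertices $v$ and $w$. For a positive integer $p$, the $p$-th power $G^p$ of a graph $G$ is the simple graph with the same vertex set as $G$ in which two distinct vertices $v,w$ are adjacent if and only if $d_G(v,w)\leq p$. A graph $G$ is $k$-ordered Hamiltonian if for any sequence $v_1,v_2,\dots,v_k$ of $k$ distinct vertices of $G$ there is a Hamiltonian cycle in $G$ containing these vertices in the given order, i.e. traversing the cycle from $v_1$ in one of its two directions, one meets $v_1,v_2,\dots,v_k$ in this order before returning to $v_1$. -}

module Defs where

open import Data.Fin.Base using (Fin; toℕ)
import Data.Fin.Properties as Fin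
open import Data.List.Base using (List; []; _∷_; _∷ʳ_; length)
open import Data.List.Membership.Propositional using (_∈_)
open import Data.List.Relation.Binary.Sublist.Propositional using (_⊆_)
open import Data.List.Relation.Unary.Linked using (Linked)
open import Data.List.Relation.Unary.Unique.Propositional using (Unique)
open import Data.Nat.Base using (ℕ; zero; suc; _≤_; _≥_; s≤s; s≤s⁻¹)
open import Data.Nat.Properties using (_≟_; allUpTo?; anyUpTo?; ≮⇒≥; <⇒≱; 1+n≢n)
open import Data.Product.Base using (∃-syntax; _×_; _,_; proj₁)
open import Data.Sum.Base using (_⊎_; inj₁; inj₂; [_,_]; swap)
open import Data.Unit.Base using (⊤)
open import Data.Vec.Base using (Vec; toList)
import Data.Vec.Relation.Unary.Unique.Propositional as Vec
open import Relation.Binary.Definitions using (Decidable; Symmetric)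
open import Relation.Binary.PropositionalEquality using (_≡_; _≢_; refl; sym; trans; ≢-sym; cong)
open import Relation.Nullary.Decidable using (Dec; map′; _×-dec_; _⊎-dec_; ¬?)

-- Finite simple graphs on n vertices.  Decidability of adjacency is the
-- constructive content of the edge set being a subset of a finite set.
record Graph (n : ℕ) : Set₁ where
  infix 4 _~_ _~?_
  field
    _~_    : Fin n → Fin n → Set
    _~?_   : Decidable _~_
    ~-sym  : Symmetric _~_
    ~⇒≢    : ∀ {v w} → v ~ w → v ≢ w

module _ {n : ℕ} (G : Graph n) where
  open Graph G

  data Walk : Fin n → Fin n → ℕ → Set where
    []  : ∀ {v} → Walk v v 0
    _∷_ : ∀ {u v w l} → u ~ v → Walk v w l → Walk u w (suc l)

  -- d_G(v,w) = d.  For v, w in different components (infinite distance) this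
  -- holds for no d.
  record Distance (v w : Fin n) (d : ℕ) : Set where
    constructor mkDistance
    field
      walk    : Walk v w d
      minimal : ∀ {l} → Walk v w l → d ≤ l

  Distance≤ : Fin n → Fin n → ℕ → Set
  Distance≤ v w p = ∃[ d ] d ≤ p × Distance v w d

  snoc : ∀ {u v w l} → Walk u v l → v ~ w → Walk u w (suc l)
  snoc []      f = f ∷ []
  snoc (e ∷ p) f = e ∷ snoc p f

  reverseWalk : ∀ {v w l} → Walk v w l → Walk w v l
  reverseWalk []      = []
  reverseWalk (e ∷ p) = snoc (reverseWalk p) (~-sym e)

  Distance-sym : ∀ {v w d} → Distance v w d → Distance w v d
  Distance-sym (mkDistance p m) = mkDistance (reverseWalk p) (λ q → m (reverseWalk q))

  walk? : ∀ v w l → Dec (Walk v w l)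
  walk? v w zero    = map′ (λ { refl → [] }) (λ { [] → refl }) (v Fin.≟ w)
  walk? v w (suc l) = map′ (λ { (_ , e , p) → e ∷ p }) (λ { (e ∷ p) → _ , e , p })
                           (Fin.any? λ u → (v ~? u) ×-dec walk? u w l)

  distance? : ∀ v w d → Dec (Distance v w d)
  distance? v w d =
    map′ (λ { (p , m) → mkDistance p (λ {l} q → ≮⇒≥ (λ l<d → m {l} l<d q)) })
         (λ { (mkDistance p m) → p , λ {l} l<d q → <⇒≱ l<d (m {l} q) })
         (walk? v w d ×-dec allUpTo? (λ l → ¬? (walk? v w l)) d)

  distance≤? : ∀ v w p → Dec (Distance≤ v w p)
  distance≤? v w p = map′ (λ { (d , d<1+p , D) → d , s≤s⁻¹ d<1+p , D })
                          (λ { (d , d≤p , D) → d , s≤s d≤p , D })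
                          (anyUpTo? (distance? v w) (suc p))

infixl 8 _^^_

_^^_ : ∀ {n} → Graph n → ℕ → Graph n
G ^^ p = record
  { _~_   = λ v w → v ≢ w × Distance≤ G v w p
  ; _~?_  = λ v w → ¬? (v Fin.≟ w) ×-dec distance≤? G v w p
  ; ~-sym = λ { (v≢w , d , d≤p , D) → ≢-sym v≢w , d , d≤p , Distance-sym G D }
  ; ~⇒≢   = proj₁
  }

-- j = i + 1 modulo n.
Next : ∀ {n} → Fin n → Fin n → Set
Next {n} i j = toℕ j ≡ suc (toℕ i) ⊎ (suc (toℕ i) ≡ n × toℕ j ≡ 0)

next? : ∀ {n} → Decidable (Next {n})
next? {n} i j = (toℕ j ≟ suc (toℕ i)) ⊎-dec ((suc (toℕ i) ≟ n) ×-dec (toℕ j ≟ 0))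

Next⇒≢ : ∀ {n} → 3 ≤ n → {i j : Fin n} → Next i j → i ≢ j
Next⇒≢ _   (inj₁ eq) refl = 1+n≢n (sym eq)
Next⇒≢ 3≤n (inj₂ (last , first)) refl with trans (sym (cong suc first)) last
... | refl with 3≤n
...   | s≤s ()

Cycle : (n : ℕ) → 3 ≤ n → Graph n
Cycle n 3≤n = record
  { _~_   = λ i j → Next i j ⊎ Next j i
  ; _~?_  = λ i j → next? i j ⊎-dec next? j i
  ; ~-sym = swap
  ; ~⇒≢   = [ Next⇒≢ 3≤n , (λ s → ≢-sym (Next⇒≢ 3≤n s)) ]
  }

-- x ∷ xs lists the vertices of a Hamiltonian cycle as they are met when it is
-- traversed once from x in one of its two directions; a cycle thus has one such
-- listing for each choice of starting vertex and direction.
record IsHamiltonianCycle {n} (G : Graph n) (x : Fin n) (xs : List (Fin n)) : Set where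
  open Graph G
  field
    length≥3 : length (x ∷ xs) ≥ 3
    edges    : Linked _~_ (x ∷ (xs ∷ʳ x))
    distinct : Unique (x ∷ xs)
    spanning : ∀ v → v ∈ (x ∷ xs)

-- The traversal x ∷ xs starts at the first of the given vertices and meets the
-- others in the given order before returning to x.
MeetsInOrder : {A : Set} → List A → A → List A → Set
MeetsInOrder []       x xs = ⊤
MeetsInOrder (v ∷ vs) x xs = v ≡ x × vs ⊆ xs

OrderedHamiltonian : ∀ {n} → ℕ → Graph n → Set
OrderedHamiltonian {n} k G =
  (vs : Vec (Fin n) k) → Vec.Unique vs →
  ∃[ x ] ∃[ xs ] IsHamiltonianCycle G x xs × MeetsInOrder (toList vs) x xs

{-# OPTIONS --safe #-}

-- The argument works for the cube of any graph with a Hamiltonian cycle C.  Up to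
-- rotation and reversal, the required order meets the five marked vertices, as they
-- lie on C, in one of four patterns.  C itself serves the pentagon.  In the other
-- patterns the new cycle runs along each gap between marked vertices in two strands.
-- Walk along C and let each free vertex extend the strand that does not end in the
-- preceding vertex, while a marked vertex extends the strand the pattern demands.
-- Steps have length at most 3 as long as no three consecutive vertices join the same
-- strand.  Free vertices never cause that, and marked ones do not either if the walk
-- starts at a place after which consecutive marked vertices are to change strands.
module Submission where

open import Defs
open import Data.Fin.Base using (Fin; zero; suc; toℕ; fromℕ)
open import Data.Fin.Properties using (toℕ-fromℕ)
open import Data.List.Base using (List; []; _∷_; [_]; _++_; map; reverse; tabulate; allFin)
open import Data.List.Membership.Propositional using (_∈_)
open import Data.List.Membership.Propositional.Properties using (∈-allFin)
open import Data.List.Properties using (unfold-reverse; length-tabulate; ++-assoc)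
open import Data.List.Relation.Binary.Permutation.Propositional
  using (_↭_; ↭⇒↭ₛ; ↭-refl; ↭-sym; ↭-trans; ↭-prep; module PermutationReasoning)
open import Data.List.Relation.Binary.Permutation.Propositional.Properties
  using (∈-resp-↭; ↭-length; ↭-reverse; ++⁺; shift; ++-comm; ∷↭∷ʳ)
import Data.List.Relation.Binary.Permutation.Setoid.Properties as Permutation
open import Data.List.Relation.Binary.Sublist.Propositional using (_⊆_; []; _∷_; _∷ʳ_; ⊆-refl; minimum; to∈; from∈)
open import Data.List.Relation.Binary.Sublist.Propositional.Properties as Sublist using (reverse⁺)
open import Data.List.Relation.Unary.All as All using (All; []; _∷_)
open import Data.List.Relation.Unary.AllPairs using ([]; _∷_)
open import Data.List.Relation.Unary.Any as Any using (Any; here; there)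
import Data.List.Relation.Unary.Any.Properties as Any
open import Data.List.Relation.Unary.Linked as Linked using (Linked; []; [-]; _∷_)
open import Data.List.Relation.Unary.Unique.Propositional using (Unique)
open import Data.List.Relation.Unary.Unique.Propositional.Properties using (allFin⁺)
open import Data.Vec.Relation.Unary.All using ([]; _∷_)
open import Data.Vec.Relation.Unary.AllPairs using ([]; _∷_)
open import Data.Vec.Base using ([]; _∷_)
open import Data.Nat.Base using (ℕ; zero; suc; _≤_; _≥_; _<_; z≤n; s≤s)
open import Data.Nat.Induction using (<-rec)
open import Data.Nat.Properties using (≤-trans; ≤-refl; m≤m+n; <⇒≤; ≮⇒≥; anyUpTo?)
open import Data.Product.Base using (∃-syntax; _×_; _,_; proj₁; proj₂)
open import Data.Sum.Base using (inj₁; inj₂)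
open import Function.Base using (_∘_; id)
open import Relation.Binary.Core using (Rel)
open import Relation.Binary.Definitions using (Symmetric)
open import Relation.Binary.PropositionalEquality
  using (_≡_; _≢_; refl; sym; trans; cong; subst; ≢-sym; setoid)
open import Relation.Nullary.Decidable using (yes; no)
open import Relation.Nullary.Negation using (contradiction)
open import Level using (0ℓ)

private variable
  A : Set
  R : Rel A 0ℓ
  x y z : A
  ws xs ys zs : List A

-- Paths with prescribed ends.

Path : Rel A 0ℓ → A → List A → A → Set
Path R x xs y = Linked R (x ∷ xs ++ [ y ])

path-++ : ∀ xs → Path R x xs y → Path R y ys z → Path R x (xs ++ y ∷ ys) z
path-++ []       (r ∷ _) q = r ∷ q
path-++ (_ ∷ xs) (r ∷ p) q = r ∷ path-++ xs p q

path-split : ∀ xs → Path R x (xs ++ y ∷ ys) z → Path R x xs y × Path R y ys z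
path-split []       (r ∷ p) = r ∷ [-] , p
path-split (_ ∷ xs) (r ∷ p) with path-split xs p
... | p₁ , p₂ = r ∷ p₁ , p₂

path-reverse : Symmetric R → ∀ xs → Path R x xs y → Path R y (reverse xs) x
path-reverse R-sym []       (r ∷ _) = R-sym r ∷ [-]
path-reverse R-sym (v ∷ xs) (r ∷ p) rewrite unfold-reverse v xs =
  path-++ (reverse xs) (path-reverse R-sym xs p) (R-sym r ∷ [-])

path-init : ∀ xs → Path R x xs y → Linked R (x ∷ xs)
path-init []       _       = [-]
path-init (_ ∷ xs) (r ∷ p) = r ∷ path-init xs p

-- Closeness allows equal vertices, adjacency in the cube does not; a listing without repetitions
-- supplies the difference. The end `y` is treated apart because a closed tour returns to its start.
path-distinct : All (_≢ y) (x ∷ xs) → Unique (x ∷ xs) → Path R x xs y →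
                Path (λ v w → v ≢ w × R v w) x xs y
path-distinct {xs = []}    (x≢y ∷ _) _                 (r ∷ _) = (x≢y , r) ∷ [-]
path-distinct {xs = _ ∷ _} (_ ∷ ≢ys) ((x≢v ∷ _) ∷ uniq) (r ∷ p) =
  (x≢v , r) ∷ path-distinct ≢ys uniq p

-- Sublists and insertions.

⊆-split : ∀ xs → xs ++ y ∷ ys ⊆ zs →
          ∃[ ps ] ∃[ qs ] zs ≡ ps ++ y ∷ qs × xs ⊆ ps × ys ⊆ qs
⊆-split [] (refl ∷ s) = [] , _ , refl , [] , s
⊆-split [] (z ∷ʳ s) with ⊆-split [] s
... | ps , qs , refl , s₁ , s₂ = z ∷ ps , qs , refl , z ∷ʳ s₁ , s₂
⊆-split (x ∷ xs) (refl ∷ s) with ⊆-split xs s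
... | ps , qs , refl , s₁ , s₂ = x ∷ ps , qs , refl , refl ∷ s₁ , s₂
⊆-split (x ∷ xs) (z ∷ʳ s) with ⊆-split (x ∷ xs) s
... | ps , qs , refl , s₁ , s₂ = z ∷ ps , qs , refl , z ∷ʳ s₁ , s₂

insertions : A → List A → List (List A)
insertions y []       = [ [ y ] ]
insertions y (x ∷ xs) = (y ∷ x ∷ xs) ∷ map (x ∷_) (insertions y xs)

insertions-head : ∀ {P : List A → Set} xs → P (y ∷ xs) → Any P (insertions y xs)
insertions-head []      p = here p
insertions-head (_ ∷ _) p = here p

⊆-insert : y ∈ ws → All (y ≢_) xs → xs ⊆ ws → Any (_⊆ ws) (insertions y xs)
⊆-insert {xs = xs} (here refl) ≢xs (_ ∷ʳ s) = insertions-head xs (refl ∷ s)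
⊆-insert (there y∈) ≢xs (z ∷ʳ s) = Any.map (z ∷ʳ_) (⊆-insert y∈ ≢xs s)
⊆-insert (here refl) (y≢x ∷ _) (refl ∷ _) = contradiction refl y≢x
⊆-insert (there y∈) (_ ∷ ≢xs) (refl ∷ s) =
  there (Any.map⁺ (Any.map (refl ∷_) (⊆-insert y∈ ≢xs s)))

odds evens : List A → List A
odds  []       = []
odds  (x ∷ xs) = x ∷ evens xs
evens []       = []
evens (x ∷ xs) = odds xs

-- Strands that take the marked vertices xs in turn continue the alternation at the
-- end: the strand due to take the next mark closes at c, the other at c′.
closer : List A → A → A → A
closer []       c c′ = c
closer (_ ∷ xs) c c′ = closer xs c′ c

-- Closed tours through marked vertices.

module _ {n : ℕ} where

  Tour : Rel (Fin n) 0ℓ → Fin n → List (Fin n) → Set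
  Tour R x ws = Path R x ws x × x ∷ ws ↭ allFin n

  TourThrough : Rel (Fin n) 0ℓ → Fin n → List (Fin n) → Set
  TourThrough R x xs = ∃[ ws ] Tour R x ws × xs ⊆ ws

  rotate : TourThrough R x (y ∷ ys) → TourThrough R y (ys ++ [ x ])
  rotate {x = x} {y = y} (ws , (p , perm) , s) with ⊆-split [] s
  ... | ps , qs , refl , _ , s′ with path-split ps p
  ...   | p₁ , p₂ = qs ++ x ∷ ps , (path-++ qs p₂ p₁ , ↭-trans (++-comm (y ∷ qs) (x ∷ ps)) perm)
                  , Sublist.++⁺ s′ (refl ∷ minimum ps)

  reflect : Symmetric R → TourThrough R x xs → TourThrough R x (reverse xs)
  reflect R-sym (ws , (p , perm) , s) =
    reverse ws , (path-reverse R-sym ws p , ↭-trans (↭-prep _ (↭-reverse ws)) perm) , reverse⁺ s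

  insert : y ≢ x → All (y ≢_) xs → TourThrough R x xs →
           Any (TourThrough R x) (insertions y xs)
  insert {y = y} y≢x ≢xs (ws , tour@(_ , perm) , s)
    with ∈-resp-↭ (↭-sym perm) (∈-allFin y)
  ... | here y≡x = contradiction y≡x y≢x
  ... | there y∈ = Any.map (λ s′ → ws , tour , s′) (⊆-insert y∈ ≢xs s)

-- Short walks and distance.

module _ {n : ℕ} (G : Graph n) where
  open Graph G

  private variable
    t u v w m m′ m₀ m₁ m₂ m₃ m₄ c c′ : Fin n
    k l p : ℕ
    us ms : List (Fin n)

  -- The walk need not be shortest, so bounds grow step by step along a path; distances are
  -- recovered only at the end.
  Within : ℕ → Fin n → Fin n → Set
  Within k v w = ∃[ l ] l ≤ k × Walk G v w l

  within-refl : Within k v v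
  within-refl = 0 , z≤n , []

  within-sym : Within k v w → Within k w v
  within-sym (l , l≤k , p) = l , l≤k , reverseWalk G p

  within-mono : k ≤ l → Within k v w → Within l v w
  within-mono k≤l (j , j≤k , p) = j , ≤-trans j≤k k≤l , p

  infixl 6 _▷_
  _▷_ : Within k u v → v ~ w → Within (suc k) u w
  (l , l≤k , p) ▷ e = suc l , s≤s l≤k , snoc G p e

  -- Strong induction on the length: replace the walk by a shorter one as long as the search finds
  -- one.
  shortest : Walk G v w l → Distance≤ G v w l
  shortest {v = v} {w} {l} = <-rec (λ l → Walk G v w l → Distance≤ G v w l) go l
    where
    go : ∀ l → (∀ {k} → k < l → Walk G v w k → Distance≤ G v w k) → Walk G v w l → Distance≤ G v w l
    go l rec p with anyUpTo? (walk? G v w) l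
    ... | no ∄ = l , ≤-refl , mkDistance p (λ {k} q → ≮⇒≥ (λ k<l → ∄ (k , k<l , q)))
    ... | yes (k , k<l , q) with rec k<l q
    ...   | d , d≤k , D = d , ≤-trans d≤k (<⇒≤ k<l) , D

  within⇒distance≤ : Within p v w → Distance≤ G v w p
  within⇒distance≤ (l , l≤p , q) with shortest q
  ... | d , d≤l , D = d , ≤-trans d≤l l≤p , D

  Near : Rel (Fin n) 0ℓ
  Near = Within 3

  -- Two strands along a walk.

  -- Two strands ending in t and u, where u is the vertex reached last, are prolonged
  -- along us until they meet.
  cover : Within 2 t u → Linked _~_ (u ∷ us) → ∃[ xs ] Path Near t xs u × xs ↭ us
  cover {us = []}     tu _       = [] , within-mono (m≤m+n 2 1) tu ∷ [-] , ↭-refl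
  -- The strand of `t` moves on to `v`, and `u` becomes the end left behind. The recursive path thus
  -- runs from `u` to `v` and gets reversed.
  cover {us = v ∷ us} tu (e ∷ p) with cover (within-refl ▷ e) p
  ... | xs , path , perm =
    v ∷ reverse xs , (tu ▷ e) ∷ path-reverse within-sym xs path , ↭-prep v (↭-trans (↭-reverse xs) perm)

  -- The mark m joins the strand of t, resp. u.  Joining the strand of u leaves t one
  -- step further behind, so it requires t to be within 1 of u.
  cover-t : Within 2 t u → Linked _~_ (u ∷ us) → m ∷ m′ ∷ [] ⊆ us →
            ∃[ xs ] Path Near t xs u × xs ↭ us × m ∷ m′ ∷ [] ⊆ xs
  cover-u : Within 1 t u → Linked _~_ (u ∷ us) → m ∷ m′ ∷ [] ⊆ us →
            ∃[ xs ] Path Near t xs u × xs ↭ us × m′ ∷ m ∷ [] ⊆ xs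

  cover-t tu (e ∷ p) (v ∷ʳ s) with cover-u (within-refl ▷ e) p s
  ... | xs , path , perm , s′ =
    v ∷ reverse xs , (tu ▷ e) ∷ path-reverse within-sym xs path
    , ↭-prep v (↭-trans (↭-reverse xs) perm) , v ∷ʳ reverse⁺ s′
  -- As `m` directly follows `t`, all else comes later on the path, so `m′` may join either strand.
  cover-t tu (e ∷ p) (refl ∷ s) with cover (within-refl ▷ e) p
  ... | xs , path , perm = _ , (tu ▷ e) ∷ path-reverse within-sym xs path
    , ↭-prep _ (↭-trans (↭-reverse xs) perm)
    , refl ∷ from∈ (∈-resp-↭ (↭-sym (↭-trans (↭-reverse xs) perm)) (to∈ s))

  cover-u tu (e ∷ p) (v ∷ʳ s) with cover-t (within-refl ▷ e) p s
  ... | xs , path , perm , s′ =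
    v ∷ reverse xs , within-mono (m≤m+n 2 1) (tu ▷ e) ∷ path-reverse within-sym xs path
    , ↭-prep v (↭-trans (↭-reverse xs) perm) , v ∷ʳ reverse⁺ s′
  -- As `m` comes right before the end `u`, `m′` precedes it on either strand.
  cover-u {m = m} tu (e ∷ p) (refl ∷ s) with cover (tu ▷ e) p
  ... | xs , path , perm =
    xs ++ [ m ] , path-++ xs path (within-refl ▷ ~-sym e ∷ [-])
    , ↭-trans (↭-sym (∷↭∷ʳ m xs)) (↭-prep m perm)
    , Sublist.++⁺ (from∈ (∈-resp-↭ (↭-sym perm) (to∈ s))) ⊆-refl

  -- As in cover, but the strands close up separately and take the marks ms in turn,
  -- starting with that of t, resp. u.
  strands-t : Within 2 t u → Path _~_ u (us ++ [ c ]) c′ → ms ⊆ us →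
    ∃[ xs ] ∃[ ys ] Path Near t xs (closer ms c c′) × Path Near u ys (closer ms c′ c) ×
                    xs ++ ys ↭ us × odds ms ⊆ xs × evens ms ⊆ ys
  strands-u : Within 1 t u → Path _~_ u (us ++ [ c ]) c′ → ms ⊆ us →
    ∃[ xs ] ∃[ ys ] Path Near t xs (closer ms c′ c) × Path Near u ys (closer ms c c′) ×
                    xs ++ ys ↭ us × evens ms ⊆ xs × odds ms ⊆ ys

  strands-t tu (e ∷ e′ ∷ [-]) [] =
    [] , [] , (tu ▷ e) ∷ [-] , (within-refl ▷ e ▷ e′) ∷ [-] , ↭-refl , [] , []
  strands-t tu (e ∷ p) (v ∷ʳ s) with strands-u (within-refl ▷ e) p s
  ... | xs , ys , path , path′ , perm , s₁ , s₂ =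
    v ∷ ys , xs , (tu ▷ e) ∷ path′ , path , ↭-prep v (↭-trans (++-comm ys xs) perm) , v ∷ʳ s₂ , s₁
  strands-t tu (e ∷ p) (refl ∷ s) with strands-t (within-refl ▷ e) p s
  ... | xs , ys , path , path′ , perm , s₁ , s₂ =
    _ ∷ ys , xs , (tu ▷ e) ∷ path′ , path , ↭-prep _ (↭-trans (++-comm ys xs) perm) , refl ∷ s₂ , s₁

  -- The strand of `t` closes at the farther end `c′`, at most 1 + 2 steps away.
  strands-u tu (e ∷ e′ ∷ [-]) [] =
    [] , [] , (tu ▷ e ▷ e′) ∷ [-] , (within-refl ▷ e) ∷ [-] , ↭-refl , [] , []
  strands-u tu (e ∷ p) (v ∷ʳ s) with strands-t (within-refl ▷ e) p s
  ... | xs , ys , path , path′ , perm , s₁ , s₂ =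
    v ∷ ys , xs , within-mono (m≤m+n 2 1) (tu ▷ e) ∷ path′ , path
    , ↭-prep v (↭-trans (++-comm ys xs) perm) , v ∷ʳ s₂ , s₁
  -- The next mark is due on the strand of `t`, so a lag of 2 is harmless.
  strands-u tu (e ∷ p) (refl ∷ s) with strands-t (tu ▷ e) p s
  ... | xs , ys , path , path′ , perm , s₁ , s₂ =
    xs , _ ∷ ys , path , (within-refl ▷ e) ∷ path′
    , ↭-trans (shift _ xs ys) (↭-prep _ perm) , s₁ , refl ∷ s₂

  -- The four patterns.

  pentagon : TourThrough _~_ m₀ ms → TourThrough Near m₀ ms
  pentagon (ws , (p , perm) , s) = ws , (Linked.map (within-refl ▷_) p , perm) , s

  -- The strands start at `m₀` and its successor `r`, alternate in taking marks, and go once round.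
  -- By the parity of the number of marks each closes where the other began, giving one cycle and
  -- not two.
  pentagram : TourThrough _~_ m₀ (m₁ ∷ m₂ ∷ m₃ ∷ m₄ ∷ []) →
              TourThrough Near m₀ (m₂ ∷ m₄ ∷ m₁ ∷ m₃ ∷ [])
  -- Here `r` is `m₁`, so `m₂` is due on the other strand.
  pentagram (r ∷ ws , (e ∷ p , perm) , refl ∷ s)
    with strands-t (within-refl ▷ e) (path-++ ws p (e ∷ [-])) s
  ... | xs , ys , path , path′ , perm′ , s₁ , s₂ =
    xs ++ r ∷ ys
    , (path-++ xs path path′ , ↭-trans (↭-prep _ (↭-trans (shift r xs ys) (↭-prep r perm′))) perm)
    , Sublist.++⁺ s₁ (refl ∷ s₂)
  pentagram (r ∷ ws , (e ∷ p , perm) , _ ∷ʳ s)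
    with strands-u (within-refl ▷ e) (path-++ ws p (e ∷ [-])) s
  ... | xs , ys , path , path′ , perm′ , s₁ , s₂ =
    xs ++ r ∷ ys
    , (path-++ xs path path′ , ↭-trans (↭-prep _ (↭-trans (shift r xs ys) (↭-prep r perm′))) perm)
    , Sublist.++⁺ s₁ (r ∷ʳ s₂)

  -- The walk starts at m₂ in both directions, one strand passing through m₂ and the
  -- other through its successor r; left is listed backwards, from m₂ to m₀.
  record Halves (m₀ m₁ m₂ m₃ m₄ : Fin n) : Set where
    field
      r           : Fin n
      left right  : List (Fin n)
      m₂~r        : m₂ ~ r
      left-linked : Linked _~_ (m₂ ∷ left)
      left-marks  : m₁ ∷ m₀ ∷ [] ⊆ left
      spanning    : m₂ ∷ right ++ r ∷ left ↭ allFin n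
      -- The end `r` is included because it may be `m₃` itself.
      right-path  : ∃[ xs ] Path Near m₂ xs r × xs ↭ right × m₄ ∷ m₃ ∷ [] ⊆ xs ++ [ r ]

  halves : TourThrough _~_ m₀ (m₁ ∷ m₂ ∷ m₃ ∷ m₄ ∷ []) → Halves m₀ m₁ m₂ m₃ m₄
  halves {m₀ = m₀} {m₁} {m₂} {m₃} {m₄} (ws , (p , perm) , s) with ⊆-split (m₁ ∷ []) s
  ... | ps , r ∷ qs , refl , s₁ , s₂ with path-split ps p
  ...   | p₁ , e ∷ p₂ = record
    { r = r ; left = reverse ps ++ [ m₀ ] ; right = qs ; m₂~r = e
    ; left-linked = path-reverse ~-sym ps p₁
    ; left-marks  = Sublist.++⁺ (reverse⁺ s₁) ⊆-refl
    ; spanning    = ↭-trans spanning perm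
    ; right-path  = rightPath s₂
    }
    where
    open PermutationReasoning
    spanning : m₂ ∷ qs ++ r ∷ reverse ps ++ [ m₀ ] ↭ m₀ ∷ ps ++ m₂ ∷ r ∷ qs
    spanning = begin
      m₂ ∷ qs ++ r ∷ reverse ps ++ [ m₀ ]     ↭⟨ ↭-prep m₂ (shift r qs _) ⟩
      (m₂ ∷ r ∷ qs) ++ reverse ps ++ [ m₀ ]   ↭⟨ ++-comm (m₂ ∷ r ∷ qs) _ ⟩
      (reverse ps ++ [ m₀ ]) ++ m₂ ∷ r ∷ qs
        ↭⟨ ++⁺ (↭-trans (↭-sym (∷↭∷ʳ m₀ _)) (↭-prep m₀ (↭-reverse ps))) ↭-refl ⟩
      m₀ ∷ ps ++ m₂ ∷ r ∷ qs                  ∎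
    rightPath : m₃ ∷ m₄ ∷ [] ⊆ r ∷ qs →
                ∃[ xs ] Path Near m₂ xs r × xs ↭ qs × m₄ ∷ m₃ ∷ [] ⊆ xs ++ [ r ]
    rightPath (refl ∷ s) with cover (within-refl ▷ e) (path-init qs p₂)
    ... | xs , path , perm = xs , path , perm , Sublist.++⁺ (from∈ (∈-resp-↭ (↭-sym perm) (to∈ s))) ⊆-refl
    rightPath (_ ∷ʳ s) with cover-u (within-refl ▷ e) (path-init qs p₂) s
    ... | xs , path , perm , s′ = xs , path , perm , Sublist.++⁺ s′ (minimum [ r ])

  close-halves : (H : Halves m₀ m₁ m₂ m₃ m₄) → let open Halves H in
    ∃[ xs ] Path Near r xs m₂ × xs ↭ left × ms ⊆ xs → TourThrough Near m₂ (m₄ ∷ m₃ ∷ ms)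
  close-halves {m₂ = m₂} H (ys , path′ , perm′ , s′) with Halves.right-path H
  ... | xs , path , perm , s = xs ++ r ∷ ys
    , (path-++ xs path path′ , ↭-trans (↭-prep m₂ (++⁺ perm (↭-prep r perm′))) spanning)
    , subst (_ ⊆_) (++-assoc xs [ r ] ys) (Sublist.++⁺ s s′)
    where open Halves H

  -- Chords are the required successions that skip a mark on the tour, here from `m₂` to `m₄` and
  -- from `m₃` to `m₀`. As `m₁` comes last before the return to `m₂`, it joins the strand of `m₂`.
  twoChords : TourThrough _~_ m₀ (m₁ ∷ m₂ ∷ m₃ ∷ m₄ ∷ []) →
              TourThrough Near m₂ (m₄ ∷ m₃ ∷ m₀ ∷ m₁ ∷ [])
  twoChords T = close-halves H (cover-u (within-refl ▷ ~-sym m₂~r) left-linked left-marks)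
    where H = halves T
          open Halves H

  -- Now `m₁` is met before `m₀` on the way from `r`, so it joins the strand of `r`.
  threeChords : TourThrough _~_ m₀ (m₁ ∷ m₂ ∷ m₃ ∷ m₄ ∷ []) →
               TourThrough Near m₂ (m₄ ∷ m₃ ∷ m₁ ∷ m₀ ∷ [])
  threeChords T = close-halves H (cover-t (within-refl ▷ ~-sym m₂~r) left-linked left-marks)
    where H = halves T
          open Halves H

  -- Hamiltonian cycles in the cube.

  tour⇒hamiltonian : n ≥ 3 → TourThrough Near v (w ∷ us) →
                     ∃[ x ] ∃[ xs ] IsHamiltonianCycle (G ^^ 3) x xs × MeetsInOrder (v ∷ w ∷ us) x xs
  tour⇒hamiltonian {v = v} n≥3 (x ∷ xs , (r ∷ path , perm) , s)
    with Permutation.Unique-resp-↭ (setoid (Fin n)) (↭⇒↭ₛ (↭-sym perm)) (allFin⁺ n)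
  ... | uniq@(v≢ ∷ uniq-xs) = v , x ∷ xs , record
    { length≥3 = subst (3 ≤_) (sym (trans (↭-length perm) (length-tabulate id))) n≥3
    ; edges    = Linked.map (λ (≢ , near) → ≢ , within⇒distance≤ near)
                   ((All.head v≢ , r) ∷ path-distinct (All.map ≢-sym v≢) uniq-xs path)
    ; distinct = uniq
    ; spanning = λ w → ∈-resp-↭ (↭-sym perm) (∈-allFin w)
    } , refl , s

  cube-ordered : n ≥ 3 → Tour _~_ v us → OrderedHamiltonian 5 (G ^^ 3)
  cube-ordered {v = v} {us} n≥3 tour (a ∷ b ∷ c ∷ d ∷ e ∷ [])
    ((a≢b ∷ a≢c ∷ a≢d ∷ a≢e ∷ []) ∷ (b≢c ∷ b≢d ∷ b≢e ∷ []) ∷ (c≢d ∷ c≢e ∷ []) ∷ (d≢e ∷ []) ∷ [] ∷ []) =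
    tour⇒hamiltonian n≥3 ordered
    where
    from-a : TourThrough _~_ a []
    from-a with ∈-resp-↭ (↭-sym (proj₂ tour)) (∈-allFin a)
    ... | here refl = us , tour , minimum us
    ... | there a∈  with rotate (us , tour , from∈ a∈)
    ...   | ws , tour′ , _ = ws , tour′ , minimum ws

    through-bc : TourThrough _~_ a (b ∷ c ∷ [])
    through-bc with insert (≢-sym a≢b) [] from-a
    ... | here T with insert (≢-sym a≢c) (≢-sym b≢c ∷ []) T
    -- Reversal puts `b` before `c`; placing `d` and `e` then leaves 3 · 4 = 12 orders.
    ...   | here T = reflect ~-sym T
    ...   | there (here T) = T

    rev~ : ∀ {x xs} → TourThrough _~_ x xs → TourThrough _~_ x (reverse xs)
    rev~ = reflect ~-sym

    rev : ∀ {x xs} → TourThrough Near x xs → TourThrough Near x (reverse xs)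
    rev = reflect within-sym

    insert-e : ∀ {xs} → All (e ≢_) xs → TourThrough _~_ a xs →
               Any (TourThrough _~_ a) (insertions e xs)
    insert-e = insert (≢-sym a≢e)

    ordered : TourThrough Near a (b ∷ c ∷ d ∷ e ∷ [])
    -- Names such as `aedbc` spell the order of the marks on the tour. Two and three chords account
    -- for five orders each, pentagon and pentagram for one each.
    ordered with insert (≢-sym a≢d) (≢-sym b≢d ∷ ≢-sym c≢d ∷ []) through-bc
    ordered | here T with insert-e (≢-sym d≢e ∷ ≢-sym b≢e ∷ ≢-sym c≢e ∷ []) T
    ... | here aedbc                         = rotate (rotate (rev (twoChords aedbc)))
    ... | there (here adebc)                 = threeChords (rev~ (rotate (rotate adebc)))
    ... | there (there (here adbec))         = pentagram adbec
    ... | there (there (there (here adbce))) = rotate (rotate (threeChords (rotate (rotate (rev~ adbce)))))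
    ordered | there (here T) with insert-e (≢-sym b≢e ∷ ≢-sym d≢e ∷ ≢-sym c≢e ∷ []) T
    ... | here aebdc                         = rev (rotate (rev (threeChords aebdc)))
    ... | there (here abedc)                 = rotate (twoChords (rotate (rev~ abedc)))
    ... | there (there (here abdec))         = rev (rotate (rotate (threeChords (rotate (rotate abdec)))))
    ... | there (there (there (here abdce))) = rotate (rev (twoChords (rev~ (rotate abdce))))
    ordered | there (there (here T)) with insert-e (≢-sym b≢e ∷ ≢-sym c≢e ∷ ≢-sym d≢e ∷ []) T
    ... | here aebcd                         = rotate (rotate (twoChords (rotate (rotate aebcd))))
    ... | there (here abecd)                 = rotate (rev (threeChords abecd))
    ... | there (there (here abced))         = rotate (rotate (rotate (twoChords abced)))
    ... | there (there (there (here abcde))) = pentagon abcde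

-- The cycle as a tour of itself.

path-tabulate : ∀ {n x} (f : Fin (suc n) → A) →
                (∀ i j → toℕ j ≡ suc (toℕ i) → R (f i) (f j)) → R (f (fromℕ n)) x →
                Path R (f zero) (tabulate (f ∘ suc)) x
path-tabulate {n = zero}  f step last = last ∷ [-]
path-tabulate {n = suc n} f step last =
  step zero (suc zero) refl ∷ path-tabulate (f ∘ suc) (λ i j → step (suc i) (suc j) ∘ cong suc) last

theorem6p1 : (n : ℕ) (n≥5 : n ≥ 5) →
    OrderedHamiltonian 5 (Cycle n (≤-trans (m≤m+n 3 2) n≥5) ^^ 3)
theorem6p1 (suc n) n≥5 = cube-ordered (Cycle (suc n) n≥3) n≥3
  ( path-tabulate id (λ _ _ → inj₁ ∘ inj₁) (inj₁ (inj₂ (cong suc (toℕ-fromℕ n) , refl)))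
  , ↭-refl )
  where n≥3 = ≤-trans (m≤m+n 3 2) n≥5
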